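{- Every finite simple undirected graph $G$ of minimum degree at least $2$ has a majority $4$-edge-coloring, i.e., an edge-coloring $c:E(G)\to\{1,2,3,4\}$ such that for every vertex $u$ of $G$ and every color $\alpha\in\{1,2,3,4\}$, at most half of the edges incident with $u$ have color $\alpha$.
   Context: A majority $k$-edge-coloring of a graph $G$ is an edge-coloring $c:E(G)\to\{1,\dots,k\}$ such that, for every vertex $u$ and every color $\alpha$, at most $d_G(u)/2$ of the edges incident with $u$ have color $\alpha$. -}

module Defs where

open import Data.Nat using (ℕ; _*_; _≤_)
open import Data.Fin using (Fin)
open import Data.Fin.Properties using (_≟_)
open import Data.Bool using (Bool; true; false; _∧_)
open import Data.List using (List; length; filterᵇ)
open import Data.List using (allFin)
open import Relation.Binary.PropositionalEquality using (_≡_)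
open import Relation.Nullary.Decidable using (⌊_⌋)

record SimpleGraph (n : ℕ) : Set where
  field
    adj    : Fin n → Fin n → Bool
    sym    : ∀ u v → adj u v ≡ adj v u
    irrefl : ∀ u → adj u u ≡ false
open SimpleGraph public

countᵇ : {n : ℕ} → (Fin n → Bool) → ℕ
countᵇ {n} p = length (filterᵇ p (allFin n))

degree : {n : ℕ} → SimpleGraph n → Fin n → ℕ
degree G u = countᵇ (adj G u)

-- An edge-colouring with k colours: a colour for each edge uv,
-- represented as a symmetric function on pairs of vertices
-- (its values on non-adjacent pairs are irrelevant).
record EdgeColoring {n : ℕ} (G : SimpleGraph n) (k : ℕ) : Set where
  field
    col     : Fin n → Fin n → Fin k
    col-sym : ∀ u v → adj G u v ≡ true → col u v ≡ col v u
open EdgeColoring public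

colorDegree : {n k : ℕ} {G : SimpleGraph n} → EdgeColoring G k → Fin n → Fin k → ℕ
colorDegree {G = G} c u α = countᵇ (λ v → adj G u v ∧ ⌊ col c u v ≟ α ⌋)

IsMajority : {n k : ℕ} {G : SimpleGraph n} → EdgeColoring G k → Set
IsMajority {n} {k} {G} c = ∀ (u : Fin n) (α : Fin k) → 2 * colorDegree c u α ≤ degree G u

MinDegree≥ : {n : ℕ} → SimpleGraph n → ℕ → Set
MinDegree≥ {n} G δ = ∀ (u : Fin n) → δ ≤ degree G u

{-# OPTIONS --safe #-}

-- Cut every vertex of degree d into ⌊d/2⌋ pieces, each incident with two edges,
-- except that one piece gets three when d is odd.  In a proper edge-colouring of the
-- resulting graph a colour occurs at most once at each piece, hence at most ⌊d/2⌋
-- times at the original vertex.  The resulting graph has maximum degree 3, so a proper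
-- 4-edge-colouring exists by Vizing's argument, in which the fan has length at most two
-- and one Kempe chain suffices.
module Submission where

open import Defs
open import Data.Bool using (Bool; true; false; _∧_; _∨_; if_then_else_)
import Data.Bool.Properties as Bool
open import Data.Empty using (⊥; ⊥-elim)
open import Data.Fin using (Fin; zero; suc; toℕ; fromℕ<)
open import Data.Fin.Permutation.Components using (transpose)
open import Data.Fin.Properties
  using (_≟_; any?; toℕ-injective; toℕ<n; fromℕ<-injective; injective⇒≤; <⇒notInjective)
open import Data.List using (List; []; _∷_; length; filter; filterᵇ; allFin; lookup; cartesianProduct; map)
open import Data.List.Membership.Propositional using (_∈_)
open import Data.List.Membership.Propositional.Properties
  using (∈-filter⁺; ∈-filter⁻; ∈-allFin; ∈-cartesianProduct⁺; ∈-lookup; ∈-map⁺)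
open import Data.List.Properties using (filter-notAll)
open import Data.List.Relation.Unary.All using (All; []; _∷_)
import Data.List.Relation.Unary.All as All
import Data.List.Relation.Unary.All.Properties as All
import Data.List.Relation.Unary.Any as Any
open import Data.List.Relation.Unary.AllPairs using ([]; _∷_)
open import Data.List.Relation.Unary.Unique.Propositional using (Unique)
import Data.List.Relation.Unary.Unique.Propositional.Properties as Unique
open import Data.Maybe using (Maybe; just; nothing)
import Data.Maybe as Maybe
open import Data.Maybe.Properties using (just-injective; ≡-dec)
open import Data.Nat using (ℕ; zero; suc; _+_; _*_; _≤_; _<_; z≤n; s≤s; ⌊_/2⌋)
open import Data.Nat.Induction using (<-wellFounded)
import Data.Nat.Properties as ℕ
open import Data.Product using (Σ; ∃; ∃₂; _×_; _,_; proj₁; proj₂; map₁)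
open import Data.Product.Properties using (×-≡,≡→≡)
import Data.Product.Properties as Product
open import Data.Sum using (_⊎_; inj₁; inj₂)
import Data.Sum as Sum
open import Function using (_∘_; id; case_of_; Injective; Equivalence)
open import Induction.WellFounded using (Acc; acc)
open import Relation.Binary using (DecidableEquality)
open import Relation.Binary.PropositionalEquality as ≡ using (_≡_; _≢_; refl; trans; cong; subst)
open import Relation.Nullary using (¬_; Dec; yes; no; does; contradiction; ¬?)
open import Relation.Nullary.Decidable using (⌊_⌋; T?; toWitness; _×-dec_; dec-true; dec-false)

-- Partial injections and counting by pigeonhole.

just≢nothing : ∀ {A : Set} {m : Maybe A} {x} → m ≡ just x → m ≡ nothing → ⊥
just≢nothing refl ()

is-nothing? : ∀ {A : Set} (m : Maybe A) → Dec (m ≡ nothing)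
is-nothing? nothing  = yes refl
is-nothing? (just _) = no λ ()

is-just! : ∀ {A : Set} {m : Maybe A} → m ≢ nothing → ∃ λ x → m ≡ just x
is-just! {m = just x}  _ = x , refl
is-just! {m = nothing} ¬n = contradiction refl ¬n

PartialInjective : ∀ {A B : Set} → (A → Maybe B) → Set
PartialInjective f = ∀ {i j p} → f i ≡ just p → f j ≡ just p → i ≡ j

-- If all values were defined, they would inject `Fin (suc n)` into `Fin n`. The use is with four
-- colours and the three edge slots at a vertex.
undefined-somewhere : ∀ {n} (f : Fin (suc n) → Maybe (Fin n)) → PartialInjective f →
  ∃ λ i → f i ≡ nothing
undefined-somewhere f inj with any? (λ i → is-nothing? (f i))
... | yes found = found
... | no  none  = ⊥-elim (<⇒notInjective (ℕ.n<1+n _) value-injective)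
  where
  value : ∀ i → ∃ λ p → f i ≡ just p
  value i = is-just! (λ e → none (i , e))
  value-injective : Injective _≡_ _≡_ (proj₁ ∘ value)
  value-injective {i} {j} e =
    inj (proj₂ (value i)) (trans (proj₂ (value j)) (cong just (≡.sym e)))

-- Giving the missed value `p` to one undefined argument keeps the map partially injective, so the
-- pigeonhole applies again and yields a second undefined argument.
undefined-twice : ∀ {n} (f : Fin (suc n) → Maybe (Fin n)) → PartialInjective f →
  ∀ p → (∀ i → f i ≢ just p) → ∃₂ λ i j → i ≢ j × f i ≡ nothing × f j ≡ nothing
undefined-twice f inj p avoids with undefined-somewhere f inj
... | i , fi = go (undefined-somewhere g g-injective)
  where
  g : _
  g j with j ≟ i
  ... | yes _ = just p
  ... | no  _ = f j
  g-injective : PartialInjective g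
  g-injective {j} {k} ej ek with j ≟ i | k ≟ i
  ... | yes refl | yes refl = refl
  ... | yes refl | no _     = contradiction (trans ek (≡.sym ej)) (avoids k)
  ... | no _     | yes refl = contradiction (trans ej (≡.sym ek)) (avoids j)
  ... | no _     | no _     = inj ej ek
  go : (∃ λ j → g j ≡ nothing) → ∃₂ λ i j → i ≢ j × f i ≡ nothing × f j ≡ nothing
  go (j , gj) with j ≟ i
  go (j , ()) | yes _
  ... | no j≢i = i , j , j≢i ∘ ≡.sym , fi , gj

unique-lookup-injective : ∀ {A : Set} {xs : List A} → Unique xs →
  ∀ i j → lookup xs i ≡ lookup xs j → i ≡ j
unique-lookup-injective (_ ∷ _)  zero    zero    _ = refl
unique-lookup-injective {xs = _ ∷ xs} (x∉ ∷ _) zero (suc j) e =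
  contradiction e (All.lookup x∉ (∈-lookup {xs = xs} j))
unique-lookup-injective {xs = _ ∷ xs} (x∉ ∷ _) (suc i) zero e =
  contradiction (≡.sym e) (All.lookup x∉ (∈-lookup {xs = xs} i))
unique-lookup-injective (_ ∷ u) (suc i) (suc j) e = cong suc (unique-lookup-injective u i j e)

-- `f` sends the positions of the list injectively into `Fin k`. Injectivity is asked on members
-- only, because the map from neighbours to pieces is injective only within one colour class.
unique-length≤ : ∀ {A : Set} {xs : List A} {k} → Unique xs →
  (f : A → ℕ) → (∀ {x} → x ∈ xs → f x < k) →
  (∀ {x y} → x ∈ xs → y ∈ xs → f x ≡ f y → x ≡ y) → length xs ≤ k
unique-length≤ {xs = xs} unique f bound inj = injective⇒≤
  {f = λ i → fromℕ< (bound (∈-lookup {xs = xs} i))} λ {i} {j} e → unique-lookup-injective unique i j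
    (inj (∈-lookup i) (∈-lookup j) (fromℕ<-injective _ _ _ _ e))

-- Exchanging two colours.

module _ {n : ℕ} (a b : Fin n) where

  -- The Boolean will be the membership of a vertex in a Kempe chain, so that one formula describes
  -- the switched colouring on and off the chain.
  swapIf : Bool → Fin n → Fin n
  swapIf s γ = if s then transpose a b γ else γ

  swapIf-involutive : ∀ s γ → swapIf s (swapIf s γ) ≡ γ
  swapIf-involutive false γ = refl
  swapIf-involutive true  γ with γ ≟ a
  ... | yes refl with b ≟ a
  ...   | yes e = e
  ...   | no _ with b ≟ b
  ...     | yes _ = refl
  ...     | no b≢b = contradiction refl b≢b
  swapIf-involutive true γ | no γ≢a with γ ≟ b
  ... | yes refl with a ≟ a
  ...   | yes _ = refl
  ...   | no a≢a = contradiction refl a≢a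
  swapIf-involutive true γ | no γ≢a | no γ≢b with γ ≟ a
  ... | yes e = contradiction e γ≢a
  ... | no _ with γ ≟ b
  ...   | yes e = contradiction e γ≢b
  ...   | no _  = refl

  swapIf-left : swapIf true a ≡ b
  swapIf-left with a ≟ a
  ... | yes _ = refl
  ... | no a≢a = contradiction refl a≢a

  swapIf-right : swapIf true b ≡ a
  swapIf-right = trans (cong (swapIf true) (≡.sym swapIf-left)) (swapIf-involutive true a)

  swapIf-fixed : ∀ {γ} → γ ≢ a → γ ≢ b → ∀ s → swapIf s γ ≡ γ
  swapIf-fixed γ≢a γ≢b false = refl
  swapIf-fixed {γ} γ≢a γ≢b true with γ ≟ a
  ... | yes e = contradiction e γ≢a
  ... | no _ with γ ≟ b
  ...   | yes e = contradiction e γ≢b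
  ...   | no _  = refl

  swapIf-cases : ∀ γ → (∀ s → swapIf s γ ≡ γ) ⊎ (∀ s → swapIf s γ ≡ a ⊎ swapIf s γ ≡ b)
  swapIf-cases γ = go (γ ≟ a) (γ ≟ b)
    where
    go : Dec (γ ≡ a) → Dec (γ ≡ b) →
      (∀ s → swapIf s γ ≡ γ) ⊎ (∀ s → swapIf s γ ≡ a ⊎ swapIf s γ ≡ b)
    go (yes refl) _          = inj₂ λ { true → inj₂ swapIf-left  ; false → inj₁ refl }
    go (no _)     (yes refl) = inj₂ λ { true → inj₁ swapIf-right ; false → inj₂ refl }
    go (no γ≢a)   (no γ≢b)   = inj₁ (swapIf-fixed γ≢a γ≢b)

-- Matchings and their alternating chains.

-- A matching is encoded by the partial map sending a vertex to its partner.
Symmetric : {V : Set} → (V → Maybe V) → Set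
Symmetric A = ∀ {u w} → A u ≡ just w → A w ≡ just u

module _ {V : Set} (_≟ᵥ_ : DecidableEquality V) where

  unlink : (V → Maybe V) → V → V → V → Maybe V
  unlink A x y u with u ≟ᵥ x | u ≟ᵥ y
  ... | yes _ | _     = nothing
  ... | no _  | yes _ = nothing
  ... | no _  | no _  = A u

  unlink-left : ∀ A x y → unlink A x y x ≡ nothing
  unlink-left A x y with x ≟ᵥ x
  ... | yes _   = refl
  ... | no x≢x = contradiction refl x≢x

  unlink-right : ∀ A x y → unlink A x y y ≡ nothing
  unlink-right A x y with y ≟ᵥ x | y ≟ᵥ y
  ... | yes _ | _      = refl
  ... | no _  | yes _  = refl
  ... | no _  | no y≢y = contradiction refl y≢y

  unlink-just⁻ : ∀ A x y {u w} → unlink A x y u ≡ just w → A u ≡ just w × u ≢ x × u ≢ y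
  unlink-just⁻ A x y {u} e with u ≟ᵥ x | u ≟ᵥ y
  ... | no u≢x | no u≢y = e , u≢x , u≢y

  unlink-just⁺ : ∀ A x y {u w} → A u ≡ just w → u ≢ x → u ≢ y → unlink A x y u ≡ just w
  unlink-just⁺ A x y {u} e u≢x u≢y with u ≟ᵥ x | u ≟ᵥ y
  ... | yes u≡x | _       = contradiction u≡x u≢x
  ... | no _    | yes u≡y = contradiction u≡y u≢y
  ... | no _    | no _    = e

  unlink-nothing : ∀ A x y {u} → A u ≡ nothing → unlink A x y u ≡ nothing
  unlink-nothing A x y {u} e with u ≟ᵥ x | u ≟ᵥ y
  ... | yes _ | _     = refl
  ... | no _  | yes _ = refl
  ... | no _  | no _  = e

  -- `x` and `y` are each other's partners, so clearing both leaves no third vertex pointing to a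
  -- cleared one.
  unlink-symmetric : ∀ {A x y} → Symmetric A → A x ≡ just y → Symmetric (unlink A x y)
  unlink-symmetric {A} {x} {y} symA Ax e with unlink-just⁻ A x y e
  ... | Au , u≢x , u≢y = unlink-just⁺ A x y (symA Au)
    (λ { refl → u≢y (just-injective (trans (≡.sym (symA Au)) Ax)) })
    (λ { refl → u≢x (just-injective (trans (≡.sym (symA Au)) (symA Ax))) })

  link : (V → Maybe V) → V → V → V → Maybe V
  link A x y u with u ≟ᵥ x | u ≟ᵥ y
  ... | yes _ | _     = just y
  ... | no _  | yes _ = just x
  ... | no _  | no _  = A u

  link-left : ∀ A x y → link A x y x ≡ just y
  link-left A x y with x ≟ᵥ x
  ... | yes _  = refl
  ... | no x≢x = contradiction refl x≢x

  link-right : ∀ A x y → link A x y y ≡ just x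
  link-right A x y with y ≟ᵥ x | y ≟ᵥ y
  ... | yes refl | _      = refl
  ... | no _     | yes _  = refl
  ... | no _     | no y≢y = contradiction refl y≢y

  link-just⁻ : ∀ A x y {u w} → link A x y u ≡ just w →
    (u ≡ x × w ≡ y) ⊎ (u ≡ y × w ≡ x) ⊎ A u ≡ just w
  link-just⁻ A x y {u} e with u ≟ᵥ x | u ≟ᵥ y
  ... | yes u≡x | _       = inj₁ (u≡x , ≡.sym (just-injective e))
  ... | no _    | yes u≡y = inj₂ (inj₁ (u≡y , ≡.sym (just-injective e)))
  ... | no _    | no _    = inj₂ (inj₂ e)

  link-just⁺ : ∀ A x y {u w} → A x ≡ nothing → A y ≡ nothing → A u ≡ just w → link A x y u ≡ just w
  link-just⁺ A x y {u} Ax Ay e with u ≟ᵥ x | u ≟ᵥ y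
  ... | yes refl | _        = ⊥-elim (just≢nothing e Ax)
  ... | no _     | yes refl = ⊥-elim (just≢nothing e Ay)
  ... | no _     | no _     = e

  link-symmetric : ∀ {A x y} → Symmetric A → A x ≡ nothing → A y ≡ nothing → Symmetric (link A x y)
  link-symmetric {A} {x} {y} symA Ax Ay e with link-just⁻ A x y e
  ... | inj₁ (refl , refl)        = link-right A x y
  ... | inj₂ (inj₁ (refl , refl)) = link-left A x y
  ... | inj₂ (inj₂ Au)            = link-just⁺ A x y Ax Ay (symA Au)

  -- Stands for the component of `v` in the union of the two matchings. Instead of a path it records
  -- what a switch uses: a vertex set closed under both matchings, in which only `v` and `otherEnd`
  -- may miss one of them. `trivial` serves the recursive construction.
  record Chain (A B : V → Maybe V) (v : V) : Set where
    field
      inside       : V → Bool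
      otherEnd     : V
      start-inside : inside v ≡ true
      closedˡ      : ∀ {u w} → A u ≡ just w → inside u ≡ inside w
      closedʳ      : ∀ {u w} → B u ≡ just w → inside u ≡ inside w
      ends         : ∀ {u} → inside u ≡ true → A u ≡ nothing ⊎ B u ≡ nothing → u ≡ v ⊎ u ≡ otherEnd
      trivial      : A v ≡ nothing → otherEnd ≡ v

  stopped : ∀ {A B v} → Symmetric A → Symmetric B → A v ≡ nothing → B v ≡ nothing → Chain A B v
  stopped {A} {B} {v} symA symB Av Bv = record
    { inside       = λ u → does (u ≟ᵥ v)
    ; otherEnd     = v
    ; start-inside = dec-true (v ≟ᵥ v) refl
    ; closedˡ      = closed symA Av
    ; closedʳ      = closed symB Bv
    ; ends         = λ {u} → ends u
    ; trivial      = λ _ → refl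
    }
    where
    closed : ∀ {C} → Symmetric C → C v ≡ nothing →
      ∀ {u w} → C u ≡ just w → does (u ≟ᵥ v) ≡ does (w ≟ᵥ v)
    closed symC Cv {u} {w} Cu with u ≟ᵥ v | w ≟ᵥ v
    ... | yes refl | _        = ⊥-elim (just≢nothing Cu Cv)
    ... | no _     | yes refl = ⊥-elim (just≢nothing (symC Cu) Cv)
    ... | no _     | no _     = refl
    ends : ∀ u {P : Set} → does (u ≟ᵥ v) ≡ true → P → u ≡ v ⊎ u ≡ v
    ends u e _ with u ≟ᵥ v
    ... | yes u≡v = inj₁ u≡v

  -- The edge from `v` to `v′` goes in front of a chain in which the matchings have exchanged roles.
  -- Deleting that edge from `A` leaves `v′` unmatched there, hence a legitimate start for the rest.
  prepend : ∀ {A B v v′} → Symmetric A → Symmetric B → A v ≡ just v′ → B v ≡ nothing →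
    Chain B (unlink A v v′) v′ → Chain A B v
  prepend {A} {B} {v} {v′} symA symB Av Bv rest = record
    { inside       = inside
    ; otherEnd     = rest.otherEnd
    ; start-inside = start-inside
    ; closedˡ      = closedˡ
    ; closedʳ      = closedʳ
    ; ends         = λ {u} → ends u
    ; trivial      = λ Av≡nothing → ⊥-elim (just≢nothing Av Av≡nothing)
    }
    where
    module rest = Chain rest
    inside : V → Bool
    inside u = does (u ≟ᵥ v) ∨ rest.inside u
    start-inside : inside v ≡ true
    start-inside = cong (_∨ rest.inside v) (dec-true (v ≟ᵥ v) refl)
    v′-inside : inside v′ ≡ true
    v′-inside = trans (cong (does (v′ ≟ᵥ v) ∨_) rest.start-inside) (Bool.∨-zeroʳ _)
    off-start : ∀ {u} → u ≢ v → inside u ≡ rest.inside u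
    off-start {u} u≢v = cong (_∨ rest.inside u) (dec-false (u ≟ᵥ v) u≢v)
    closedˡ : ∀ {u w} → A u ≡ just w → inside u ≡ inside w
    closedˡ {u} {w} Au = go (u ≟ᵥ v) (u ≟ᵥ v′)
      where
      go : Dec (u ≡ v) → Dec (u ≡ v′) → inside u ≡ inside w
      go (yes refl) _ with refl ← trans (≡.sym Av) Au = trans start-inside (≡.sym v′-inside)
      go (no _) (yes refl) with refl ← trans (≡.sym (symA Av)) Au = trans v′-inside (≡.sym start-inside)
      go (no u≢v) (no u≢v′) = trans (off-start u≢v)
        (trans (rest.closedʳ (unlink-just⁺ A v v′ Au u≢v u≢v′))
          (≡.sym (off-start λ { refl → u≢v′ (just-injective (trans (≡.sym (symA Au)) Av)) })))
    closedʳ : ∀ {u w} → B u ≡ just w → inside u ≡ inside w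
    closedʳ Bu = trans (off-start λ { refl → just≢nothing Bu Bv })
      (trans (rest.closedˡ Bu) (≡.sym (off-start λ { refl → just≢nothing (symB Bu) Bv })))
    ends : ∀ u → inside u ≡ true → A u ≡ nothing ⊎ B u ≡ nothing → u ≡ v ⊎ u ≡ rest.otherEnd
    ends u e free with u ≟ᵥ v
    ... | yes u≡v = inj₁ u≡v
    ... | no _ with rest.ends e (Sum.swap (Sum.map₁ (unlink-nothing A v v′) free))
    ...   | inj₂ u≡end = inj₂ u≡end
    -- The start `v′` of the shorter chain is now matched to `v` in `A`. It can still be an end only
    -- by missing `B`, and then `trivial` identifies it with `otherEnd`.
    ...   | inj₁ refl with free
    ...     | inj₁ Av′ = ⊥-elim (just≢nothing (symA Av) Av′)
    ...     | inj₂ Bv′ = inj₂ (≡.sym (rest.trivial Bv′))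

  -- The path is followed from `v` along alternating edges, by induction on the length of a list
  -- containing every matched vertex.
  chain : ∀ {A B} → Symmetric A → Symmetric B →
    (L : List V) → Acc _<_ (length L) →
    (∀ {u w} → A u ≡ just w → u ∈ L) → (∀ {u w} → B u ≡ just w → u ∈ L) →
    ∀ {v} → B v ≡ nothing → Chain A B v
  chain {A} {B} symA symB L (acc rec) A⊆L B⊆L {v} Bv with A v in Av
  ... | nothing = stopped symA symB Av Bv
  ... | just v′ = prepend symA symB Av Bv
    -- `v` is in `L`, being matched in `A`, so filtering it out shortens the list. Neither `B` nor
    -- the reduced `A` matches `v`, so the filtered list still contains all matched vertices.
    (chain symB (unlink-symmetric symA Av) (filter ≢v? L)
      (rec (filter-notAll ≢v? L (Any.map (λ e ¬e → ¬e (≡.sym e)) (A⊆L Av))))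
      (λ Bu → ∈-filter⁺ ≢v? (B⊆L Bu) λ { refl → just≢nothing Bu Bv })
      (λ A′u → let Au , u≢v , _ = unlink-just⁻ A v v′ A′u in ∈-filter⁺ ≢v? (A⊆L Au) u≢v)
      (unlink-right A v v′))
    where
    ≢v? : ∀ u → Dec (u ≢ v)
    ≢v? u = ¬? (u ≟ᵥ v)

-- Proper 4-edge-colouring of graphs of maximum degree three.

module Subcubic
  {V : Set} (_≟ᵥ_ : DecidableEquality V) (E : V → V → Set)
  (E-sym : ∀ {u w} → E u w → E w u) (E-irrefl : ∀ {u} → ¬ E u u)
  -- The degree bound is expressed by an injective numbering of the edges at each vertex.
  (port : V → V → Fin 3)
  (port-injective : ∀ {u w w′} → E u w → E u w′ → port u w ≡ port u w′ → w ≡ w′)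
  (vertices : List V) (complete : ∀ {u w} → E u w → u ∈ vertices)
  where

  -- A partial proper edge-colouring, stored as one matching per colour. Properness is built in,
  -- since a colour gives a vertex at most one partner; `single` says that an edge has at most one
  -- colour.
  record Coloured : Set where
    field
      mate     : Fin 4 → V → Maybe V
      mate-sym : ∀ γ → Symmetric (mate γ)
      single   : ∀ {γ δ v w} → mate γ v ≡ just w → mate δ v ≡ just w → γ ≡ δ
      edge     : ∀ {γ v w} → mate γ v ≡ just w → E v w

    Covered : V → V → Set
    Covered u w = ∃ λ γ → mate γ u ≡ just w

    Free : Fin 4 → V → Set
    Free γ v = mate γ v ≡ nothing

  open Coloured

  -- Only the set of coloured edges has to grow; their colours may change, as they do in rotations
  -- and switches.
  _⊑_ : Coloured → Coloured → Set
  c ⊑ c′ = ∀ {u w} → Covered c u w → Covered c′ u w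

  covered? : ∀ c u w → Dec (Covered c u w)
  covered? c u w = any? (λ γ → ≡-dec _≟ᵥ_ (mate c γ u) (just w))

  covered-sym : ∀ c {u w} → Covered c u w → Covered c w u
  covered-sym c (γ , e) = γ , mate-sym c γ e

  ports : Coloured → V → Fin 4 → Maybe (Fin 3)
  ports c v γ = Maybe.map (port v) (mate c γ v)

  ports-just⁻ : ∀ c v γ {p} → ports c v γ ≡ just p → ∃ λ w → mate c γ v ≡ just w × port v w ≡ p
  ports-just⁻ c v γ e with mate c γ v
  ... | just w = w , refl , just-injective e

  ports-nothing⁻ : ∀ c v γ → ports c v γ ≡ nothing → Free c γ v
  ports-nothing⁻ c v γ e with mate c γ v
  ... | nothing = refl

  ports-injective : ∀ c v → PartialInjective (ports c v)
  ports-injective c v {γ} {δ} eγ eδ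
    with w , mγ , pw ← ports-just⁻ c v γ eγ | w′ , mδ , pw′ ← ports-just⁻ c v δ eδ
    with refl ← port-injective (edge c mγ) (edge c mδ) (trans pw (≡.sym pw′)) = single c mγ mδ

  one-free : ∀ c v → ∃ λ γ → Free c γ v
  one-free c v = let γ , e = undefined-somewhere (ports c v) (ports-injective c v)
    in γ , ports-nothing⁻ c v γ e

  -- The uncoloured edge occupies a port at `u` that no colour uses, which leaves two ports for four
  -- colours.
  two-free : ∀ c {u w} → E u w → ¬ Covered c u w → ∃₂ λ γ δ → γ ≢ δ × Free c γ u × Free c δ u
  two-free c {u} {w} uw uncovered =
    let γ , δ , γ≢δ , eγ , eδ = undefined-twice (ports c u) (ports-injective c u) (port u w) avoids
    in γ , δ , γ≢δ , ports-nothing⁻ c u γ eγ , ports-nothing⁻ c u δ eδ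
    where
    avoids : ∀ γ → ports c u γ ≢ just (port u w)
    avoids γ e = let _ , m , p = ports-just⁻ c u γ e in
      uncovered (γ , trans m (cong just (port-injective (edge c m) uw p)))

  _[_]≔_ : (Fin 4 → V → Maybe V) → Fin 4 → (V → Maybe V) → Fin 4 → V → Maybe V
  (M [ γ ]≔ A) δ with δ ≟ γ
  ... | yes _ = A
  ... | no _  = M δ

  update-at : ∀ M γ A v → (M [ γ ]≔ A) γ v ≡ A v
  update-at M γ A v with γ ≟ γ
  ... | yes _  = refl
  ... | no γ≢γ = contradiction refl γ≢γ

  update-other : ∀ M {γ δ} A v → δ ≢ γ → (M [ γ ]≔ A) δ v ≡ M δ v
  update-other M {γ} {δ} A v δ≢γ with δ ≟ γ
  ... | yes e = contradiction e δ≢γ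
  ... | no _  = refl

  module Colour (c : Coloured) {x y : V} (xy : E x y) (γ : Fin 4)
    (uncovered : ¬ Covered c x y) (x-free : Free c γ x) (y-free : Free c γ y) where

    A : V → Maybe V
    A = link _≟ᵥ_ (mate c γ) x y

    new : ∀ {v w} → A v ≡ just w → mate c γ v ≡ just w ⊎ (E v w × ¬ Covered c v w)
    new e with link-just⁻ _≟ᵥ_ (mate c γ) x y e
    ... | inj₁ (refl , refl)        = inj₂ (xy , uncovered)
    ... | inj₂ (inj₁ (refl , refl)) = inj₂ (E-sym xy , uncovered ∘ covered-sym c)
    ... | inj₂ (inj₂ e′)            = inj₁ e′

    coloured : Coloured
    coloured .mate = mate c [ γ ]≔ A
    coloured .mate-sym δ with δ ≟ γ
    ... | yes _ = link-symmetric _≟ᵥ_ (mate-sym c γ) x-free y-free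
    ... | no _  = mate-sym c δ
    coloured .single {δ} {ε} eδ eε with δ ≟ γ | ε ≟ γ
    ... | yes refl | yes refl = refl
    ... | no _     | no _     = single c eδ eε
    ... | yes refl | no _ with new eδ
    ...   | inj₁ e        = single c e eε
    ...   | inj₂ (_ , ¬c) = contradiction (ε , eε) ¬c
    coloured .single {δ} {ε} eδ eε | no _ | yes refl with new eε
    ...   | inj₁ e        = single c eδ e
    ...   | inj₂ (_ , ¬c) = contradiction (δ , eδ) ¬c
    coloured .edge {δ} e with δ ≟ γ
    ... | no _  = edge c e
    ... | yes _ with new e
    ...   | inj₁ e′       = edge c e′
    ...   | inj₂ (vw , _) = vw

    extends : c ⊑ coloured
    extends {u} (δ , e) with δ ≟ γ in eq
    ... | yes refl = γ , trans (update-at (mate c) γ A u) (link-just⁺ _≟ᵥ_ (mate c γ) x y x-free y-free e)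
    ... | no δ≢γ   = δ , trans (update-other (mate c) A u δ≢γ) e

    covers : Covered coloured x y
    covers = γ , trans (update-at (mate c) γ A x) (link-left _≟ᵥ_ (mate c γ) x y)

    unchanged : ∀ {δ} v → δ ≢ γ → mate coloured δ v ≡ mate c δ v
    unchanged v = update-other (mate c) A v

  Extension : Coloured → V → V → Set
  Extension c x y = Σ Coloured λ c′ → c ⊑ c′ × Covered c′ x y

  -- Testing again whether the edge is covered lets callers apply this after a recolouring without
  -- showing that the edge stayed uncoloured.
  colour-free : ∀ c {x y} → E x y → ∀ γ → Free c γ x → Free c γ y → Extension c x y
  colour-free c {x} {y} xy γ x-free y-free with covered? c x y
  ... | yes covered  = c , id , covered
  ... | no uncovered = coloured , extends , covers
    where open Colour c xy γ uncovered x-free y-free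

  module Uncolour (c : Coloured) {x z : V} (γ : Fin 4) (xz : mate c γ x ≡ just z) where

    A : V → Maybe V
    A = unlink _≟ᵥ_ (mate c γ) x z

    old : ∀ {δ v w} → (mate c [ γ ]≔ A) δ v ≡ just w → mate c δ v ≡ just w
    old {δ} e with δ ≟ γ
    ... | yes refl = proj₁ (unlink-just⁻ _≟ᵥ_ (mate c γ) x z e)
    ... | no _     = e

    uncoloured : Coloured
    uncoloured .mate = mate c [ γ ]≔ A
    uncoloured .mate-sym δ with δ ≟ γ
    ... | yes refl = unlink-symmetric _≟ᵥ_ (mate-sym c γ) xz
    ... | no _     = mate-sym c δ
    uncoloured .single {δ} {ε} eδ eε = single c (old {δ} eδ) (old {ε} eε)
    uncoloured .edge {δ} e = edge c (old {δ} e)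

    still-free : ∀ {δ v} → Free c δ v → Free uncoloured δ v
    still-free {δ} {v} e with mate uncoloured δ v in eq
    ... | nothing = refl
    ... | just w  = ⊥-elim (just≢nothing (old {δ} eq) e)

    now-free : Free uncoloured γ x
    now-free = trans (update-at (mate c) γ A x) (unlink-left _≟ᵥ_ (mate c γ) x z)

    uncovered : ¬ Covered uncoloured x z
    uncovered (δ , e) with refl ← single c (old {δ} e) xz = just≢nothing e now-free

    keeps : ∀ {u w} → Covered c u w → Covered uncoloured u w ⊎ (u ≡ x × w ≡ z) ⊎ (u ≡ z × w ≡ x)
    keeps {u} {w} (δ , e) with δ ≟ γ
    ... | no δ≢γ   = inj₁ (δ , trans (update-other (mate c) A u δ≢γ) e)
    ... | yes refl with u ≟ᵥ x | u ≟ᵥ z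
    ...   | yes refl | _        = inj₂ (inj₁ (refl , just-injective (trans (≡.sym e) xz)))
    ...   | no _     | yes refl = inj₂ (inj₂ (refl , just-injective (trans (≡.sym e) (mate-sym c γ xz))))
    ...   | no u≢x   | no u≢z   =
      inj₁ (γ , trans (update-at (mate c) γ A u) (unlink-just⁺ _≟ᵥ_ (mate c γ) x z e u≢x u≢z))

  -- Recolouring `xz` from `β` to `μ` releases `β` at `x`; as `β` is also free at `y`, the edge `xy`
  -- can take it.
  rotate : ∀ c {x y z} → E x y → ∀ β μ → mate c β x ≡ just z →
    Free c μ x → Free c μ z → Free c β y → Extension c x y
  rotate c {x} {y} {z} xy β μ xz μx μz βy =
    let c′ , ext , cov = colour-free R.coloured xy β
          (trans (R.unchanged x β≢μ) U.now-free) (trans (R.unchanged y β≢μ) (U.still-free βy))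
    in c′ , ext ∘ kept , cov
    where
    β≢μ : β ≢ μ
    β≢μ refl = just≢nothing xz μx
    module U = Uncolour c β xz
    module R = Colour U.uncoloured (edge c xz) μ U.uncovered (U.still-free μx) (U.still-free μz)
    kept : c ⊑ R.coloured
    kept cov with U.keeps cov
    ... | inj₁ cov′                 = R.extends cov′
    ... | inj₂ (inj₁ (refl , refl)) = R.covers
    ... | inj₂ (inj₂ (refl , refl)) = covered-sym R.coloured R.covers

  module Switch (c : Coloured) (α μ : Fin 4) {z : V} (K : Chain _≟ᵥ_ (mate c α) (mate c μ) z) where
    open Chain K

    closed : ∀ {γ v w} → γ ≡ α ⊎ γ ≡ μ → mate c γ v ≡ just w → inside v ≡ inside w
    closed (inj₁ refl) = closedˡ
    closed (inj₂ refl) = closedʳ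

    switched : Coloured
    switched .mate γ v = mate c (swapIf α μ (inside v) γ) v
    switched .mate-sym γ {v} {w} e = trans (cong (λ δ → mate c δ w) (≡.sym same)) (mate-sym c _ e)
      where
      -- Either `γ` is untouched by the exchange, or the edge has colour `α` or `μ` and both its
      -- ends lie on the same side of the chain.
      same : swapIf α μ (inside v) γ ≡ swapIf α μ (inside w) γ
      same with swapIf-cases α μ γ
      ... | inj₁ fixed = trans (fixed (inside v)) (≡.sym (fixed (inside w)))
      ... | inj₂ moved = cong (λ s → swapIf α μ s γ) (closed (moved (inside v)) e)
    switched .single {γ} {δ} {v} eγ eδ =
      trans (≡.sym (swapIf-involutive α μ (inside v) γ))
        (trans (cong (swapIf α μ (inside v)) (single c eγ eδ)) (swapIf-involutive α μ (inside v) δ))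
    switched .edge = edge c

    extends : c ⊑ switched
    extends {u} (γ , e) = swapIf α μ (inside u) γ ,
      trans (cong (λ δ → mate c δ u) (swapIf-involutive α μ (inside u) γ)) e

    mate-inside : ∀ {v} → inside v ≡ true → mate switched α v ≡ mate c μ v × mate switched μ v ≡ mate c α v
    mate-inside {v} e rewrite e =
      cong (λ δ → mate c δ v) (swapIf-left α μ) , cong (λ δ → mate c δ v) (swapIf-right α μ)

    mate-outside : ∀ {v} γ → inside v ≡ false → mate switched γ v ≡ mate c γ v
    mate-outside γ e rewrite e = refl

    mate-other : ∀ {γ} v → γ ≢ α → γ ≢ μ → mate switched γ v ≡ mate c γ v
    mate-other v γ≢α γ≢μ = cong (λ δ → mate c δ v) (swapIf-fixed α μ γ≢α γ≢μ (inside v))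

  -- Otherwise `μ` would be a fifth distinct element of `Fin 4`.
  exhaustive : ∀ {α α′ β β′ : Fin 4} → α ≢ α′ → β ≢ β′ →
    α ≢ β → α ≢ β′ → α′ ≢ β → α′ ≢ β′ → ∀ μ → (μ ≡ α ⊎ μ ≡ α′) ⊎ (μ ≡ β ⊎ μ ≡ β′)
  exhaustive {α} {α′} {β} {β′} p q r s t u μ with μ ≟ α | μ ≟ α′ | μ ≟ β | μ ≟ β′
  ... | yes e | _ | _ | _ = inj₁ (inj₁ e)
  ... | no _ | yes e | _ | _ = inj₁ (inj₂ e)
  ... | no _ | no _ | yes e | _ = inj₂ (inj₁ e)
  ... | no _ | no _ | no _ | yes e = inj₂ (inj₂ e)
  ... | no a | no b | no d | no e =
    contradiction (unique-length≤ five toℕ (λ _ → toℕ<n _) (λ _ _ → toℕ-injective))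
      λ { (s≤s (s≤s (s≤s (s≤s ())))) }
    where
    five : Unique (μ ∷ α ∷ α′ ∷ β ∷ β′ ∷ [])
    five = (a ∷ b ∷ d ∷ e ∷ []) ∷ (p ∷ r ∷ s ∷ []) ∷ (t ∷ u ∷ []) ∷ (q ∷ []) ∷ [] ∷ []

  -- Each end of the uncoloured edge has two free colours. With no common free colour these are four
  -- distinct colours, hence all of them.
  free-at-an-end : ∀ c {x y} → E x y → ¬ Covered c x y →
    ¬ (∃ λ γ → Free c γ x × Free c γ y) → ∀ μ → Free c μ x ⊎ Free c μ y
  free-at-an-end c {x} {y} xy uncovered disjoint μ =
    let α , α′ , α≢α′ , αx , α′x = two-free c xy uncovered
        β , β′ , β≢β′ , βy , β′y = two-free c (E-sym xy) (uncovered ∘ covered-sym c)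
    in Sum.map (transfer αx α′x) (transfer βy β′y)
         (exhaustive α≢α′ β≢β′ (separate αx βy) (separate αx β′y) (separate α′x βy) (separate α′x β′y) μ)
    where
    separate : ∀ {γ δ} → Free c γ x → Free c δ y → γ ≢ δ
    separate γx δy refl = disjoint (_ , γx , δy)
    transfer : ∀ {v γ δ} → Free c γ v → Free c δ v → μ ≡ γ ⊎ μ ≡ δ → Free c μ v
    transfer γv δv (inj₁ refl) = γv
    transfer γv δv (inj₂ refl) = δv

  -- The α-μ chain ending in z has only one other end, so it cannot contain both x and y.
  kempe : ∀ c {x y z} → E x y → ∀ α β μ → mate c β x ≡ just z →
    Free c α x → Free c μ y → Free c β y → Free c μ z → Extension c x y
  kempe c {x} {y} {z} xy α β μ xz αx μy βy μz = by-side (inside x) (inside y) refl refl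
    where
    K : Chain _≟ᵥ_ (mate c α) (mate c μ) z
    K = chain _≟ᵥ_ (mate-sym c α) (mate-sym c μ) vertices (<-wellFounded _)
      (complete ∘ edge c) (complete ∘ edge c) μz
    open Chain K
    open Switch c α μ K
    β-unchanged : ∀ v → mate switched β v ≡ mate c β v
    β-unchanged v = mate-other v
      (λ { refl → just≢nothing xz αx }) (λ { refl → just≢nothing (mate-sym c β xz) μz })
    through-switch : Extension switched x y → Extension c x y
    through-switch (c′ , ext , cov) = c′ , ext ∘ extends , cov
    at-otherEnd : ∀ {v} → v ≢ z → inside v ≡ true → Free c α v ⊎ Free c μ v → v ≡ otherEnd
    at-otherEnd v≢z v-in free with ends v-in free
    ... | inj₁ v≡z = contradiction v≡z v≢z
    ... | inj₂ v≡end = v≡end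
    by-side : ∀ s t → inside x ≡ s → inside y ≡ t → Extension c x y
    -- The switch makes `α` free at `z` and leaves it free at `x`, so `xz` can take `α` and hand `β`
    -- to `xy`.
    by-side false _ x-out _ = through-switch (rotate switched xy β α
      (trans (β-unchanged x) xz)
      (trans (mate-outside α x-out) αx)
      (trans (proj₁ (mate-inside start-inside)) μz)
      (trans (β-unchanged y) βy))
    -- The switch makes `μ` free at `x` and leaves it free at `y`.
    by-side true false x-in y-out = through-switch (colour-free switched xy μ
      (trans (proj₂ (mate-inside x-in)) αx) (trans (mate-outside μ y-out) μy))
    by-side true true x-in y-in = contradiction (subst (E x) (trans y-end (≡.sym x-end)) xy) E-irrefl
      where
      x-end : x ≡ otherEnd
      x-end = at-otherEnd (λ { refl → E-irrefl (edge c xz) }) x-in (inj₁ αx)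
      y-end : y ≡ otherEnd
      y-end = at-otherEnd (λ { refl → just≢nothing (mate-sym c β xz) βy }) y-in (inj₂ μy)

  -- Without a common free colour, a colour `β` free at `y` appears at `x` on some edge `xz`. A
  -- colour `μ` free at `z` is free at `x` or at `y`: the first case is a rotation, the second needs
  -- a Kempe switch.
  extend : ∀ c {x y} → E x y → Extension c x y
  extend c {x} {y} xy with covered? c x y
  ... | yes covered = c , id , covered
  ... | no uncovered with any? (λ γ → is-nothing? (mate c γ x) ×-dec is-nothing? (mate c γ y))
  ...   | yes (γ , γx , γy) = colour-free c xy γ γx γy
  ...   | no disjoint =
    let α , αx = one-free c x
        β , βy = one-free c y
        z , xz = is-just! λ βx → disjoint (β , βx , βy)
        μ , μz = one-free c z
    in Sum.[ (λ μx → rotate c xy β μ xz μx μz βy) , (λ μy → kempe c xy α β μ xz αx μy βy μz) ]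
         (free-at-an-end c xy uncovered disjoint μ)

  empty : Coloured
  empty = record { mate = λ _ _ → nothing ; mate-sym = λ _ () ; single = λ () ; edge = λ () }

  colouring : ∀ {es : List (V × V)} → All (λ (u , w) → E u w) es →
    Σ Coloured λ c → All (λ (u , w) → Covered c u w) es
  colouring []         = empty , []
  colouring (uw ∷ uws)
    with c , covers ← colouring uws
    with c′ , ext , cov ← extend c uw
    = c′ , cov ∷ All.map ext covers

-- Distributing the edges at a vertex among its pieces.

module _ {n : ℕ} where

  position : List (Fin n) → Fin n → ℕ
  position []       v = zero
  position (x ∷ xs) v with v ≟ x
  ... | yes _ = zero
  ... | no _  = suc (position xs v)

  position<length : ∀ {xs v} → v ∈ xs → position xs v < length xs
  position<length {x ∷ xs} {v} v∈ with v ≟ x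
  ... | yes _  = s≤s z≤n
  ... | no v≢x = s≤s (position<length (Any.tail v≢x v∈))

  position-injective : ∀ {xs v w} → v ∈ xs → w ∈ xs → position xs v ≡ position xs w → v ≡ w
  position-injective {x ∷ xs} {v} {w} v∈ w∈ e with v ≟ x | w ≟ x
  ... | yes v≡x | yes w≡x = trans v≡x (≡.sym w≡x)
  ... | no v≢x  | no w≢x  =
    position-injective (Any.tail v≢x v∈) (Any.tail w≢x w∈) (ℕ.suc-injective e)

-- place d r is the piece, and the slot in that piece, of the edge number r at a vertex of degree d.
place : ℕ → ℕ → ℕ × Fin 3
place _                         zero          = 0 , zero
place _                         (suc zero)    = 0 , suc zero
-- A further piece is opened only when at least two edges remain for it, hence the pattern of degree
-- at least four.
place (suc (suc d@(suc (suc _)))) (suc (suc r)) = map₁ suc (place d r)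
-- For degree three this is the third edge of the last piece; the other cases are excluded by
-- `r < d`.
place _                         (suc (suc _)) = 0 , suc (suc zero)

-- The minimum degree enters here: at degree one there would be an edge but ⌊1/2⌋ = 0 pieces.
place-bound : ∀ {d} r → 2 ≤ d → r < d → proj₁ (place d r) < ⌊ d /2⌋
place-bound zero       (s≤s (s≤s _)) _ = s≤s z≤n
place-bound (suc zero) (s≤s (s≤s _)) _ = s≤s z≤n
place-bound {suc (suc zero)} (suc (suc r)) _ (s≤s (s≤s ()))
place-bound {suc (suc (suc zero))} (suc (suc r)) _ _ = s≤s z≤n
place-bound {suc (suc (suc (suc d)))} (suc (suc r)) _ (s≤s (s≤s r<d)) =
  s≤s (place-bound r (s≤s (s≤s z≤n)) r<d)

-- All pieces before the last hold exactly two edges, so the formula is right even for the third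
-- slot of the last piece.
place-decode : ∀ {d} r → r < d → proj₁ (place d r) * 2 + toℕ (proj₂ (place d r)) ≡ r
place-decode zero       _ = refl
place-decode (suc zero) _ = refl
place-decode {suc (suc zero)}             (suc (suc r))       (s≤s (s≤s ()))
place-decode {suc (suc (suc zero))}       (suc (suc zero))    _ = refl
place-decode {suc (suc (suc zero))}       (suc (suc (suc r))) (s≤s (s≤s (s≤s ())))
place-decode {suc (suc (suc (suc d)))}    (suc (suc r))       (s≤s (s≤s r<d)) =
  cong (2 +_) (place-decode r r<d)

place-injective : ∀ d {r s} → r < d → s < d → place d r ≡ place d s → r ≡ s
place-injective d r<d s<d e =
  trans (≡.sym (place-decode _ r<d))
    (trans (cong (λ (p , slot) → p * 2 + toℕ slot) e) (place-decode _ s<d))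

-- The split graph and the majority colouring.

module Split {n : ℕ} (G : SimpleGraph n) (δ≥2 : MinDegree≥ G 2) where

  V : Set
  V = Fin n × ℕ

  neighbours : Fin n → List (Fin n)
  neighbours u = filterᵇ (adj G u) (allFin n)

  spot : Fin n → Fin n → ℕ × Fin 3
  spot u v = place (degree G u) (position (neighbours u) v)

  end : Fin n → Fin n → V
  end u v = u , proj₁ (spot u v)

  ∈-neighbours : ∀ {u v} → adj G u v ≡ true → v ∈ neighbours u
  ∈-neighbours {u} {v} uv = ∈-filter⁺ (T? ∘ adj G u) (∈-allFin v) (Equivalence.from Bool.T-≡ uv)

  spot-injective : ∀ {u v w} → adj G u v ≡ true → adj G u w ≡ true → spot u v ≡ spot u w → v ≡ w
  spot-injective {u} uv uw e = position-injective (∈-neighbours uv) (∈-neighbours uw)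
    (place-injective (degree G u) (position<length (∈-neighbours uv)) (position<length (∈-neighbours uw)) e)

  -- Each edge of `G` survives as one edge, joining the pieces that hold it at its two ends. Pairs
  -- with a piece number out of range are isolated vertices.
  E : V → V → Set
  E x@(u , _) y@(v , _) = adj G u v ≡ true × x ≡ end u v × y ≡ end v u

  E-sym : ∀ {x y} → E x y → E y x
  E-sym {u , _} {v , _} (uv , x≡ , y≡) = trans (SimpleGraph.sym G v u) uv , y≡ , x≡

  E-irrefl : ∀ {x} → ¬ E x x
  E-irrefl {u , _} (uu , _) = case trans (≡.sym uu) (irrefl G u) of λ ()

  port : V → V → Fin 3
  port (u , _) (v , _) = proj₂ (spot u v)

  port-injective : ∀ {x y z} → E x y → E x z → port x y ≡ port x z → y ≡ z
  port-injective {u , _} {v , _} {w , _} (uv , x≡v , y≡) (uw , x≡w , z≡) e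
    with refl ← spot-injective uv uw (×-≡,≡→≡ (cong proj₂ (trans (≡.sym x≡v) x≡w) , e))
    = trans y≡ (≡.sym z≡)

  pairs : List (Fin n × Fin n)
  pairs = cartesianProduct (allFin n) (allFin n)

  ∈-pairs : ∀ u v → (u , v) ∈ pairs
  ∈-pairs u v = ∈-cartesianProduct⁺ (∈-allFin u) (∈-allFin v)

  complete : ∀ {x y} → E x y → x ∈ map (λ (u , v) → end u v) pairs
  complete {u , _} {v , _} (_ , refl , _) = ∈-map⁺ _ (∈-pairs u v)

  open Subcubic (Product.≡-dec _≟_ ℕ._≟_) E E-sym E-irrefl port port-injective _ complete
  open Coloured

  adjacent? : ∀ ((u , v) : Fin n × Fin n) → Dec (adj G u v ≡ true)
  adjacent? (u , v) = adj G u v Bool.≟ true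

  -- Every edge is listed in both orientations; whichever is treated second is found already
  -- covered.
  edges : List (V × V)
  edges = map (λ (u , v) → end u v , end v u) (filter adjacent? pairs)

  split : Σ Coloured λ c → All (λ (x , y) → Covered c x y) edges
  split = colouring (All.map⁺ (All.map (λ uv → uv , refl , refl) (All.all-filter adjacent? pairs)))

  c : Coloured
  c = proj₁ split

  covered : ∀ {u v} → adj G u v ≡ true → Covered c (end u v) (end v u)
  covered {u} {v} uv = All.lookup (proj₂ split) (∈-map⁺ _ (∈-filter⁺ adjacent? (∈-pairs u v) uv))

  colour : Fin n → Fin n → Fin 4
  colour u v with adjacent? (u , v)
  ... | yes uv = proj₁ (covered uv)
  ... | no _   = zero

  colour-mate : ∀ {u v} → adj G u v ≡ true → mate c (colour u v) (end u v) ≡ just (end v u)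
  colour-mate {u} {v} uv with adjacent? (u , v)
  ... | yes uv′ = proj₂ (covered uv′)
  ... | no ¬uv  = contradiction uv ¬uv

  edgeColoring : EdgeColoring G 4
  edgeColoring .col = colour
  edgeColoring .col-sym u v uv =
    -- The two colours come from separate list entries, but both are colours of the same split edge,
    -- so they agree.
    single c (colour-mate uv) (mate-sym c _ (colour-mate (trans (SimpleGraph.sym G v u) uv)))

  majority : IsMajority edgeColoring
  majority u α = ℕ.≤-trans (ℕ.*-monoʳ-≤ 2 at-most-half) (2*⌊n/2⌋≤n (degree G u))
    where
    2*⌊n/2⌋≤n : ∀ m → 2 * ⌊ m /2⌋ ≤ m
    2*⌊n/2⌋≤n m = ℕ.≤-trans
      (ℕ.+-monoʳ-≤ ⌊ m /2⌋ (ℕ.≤-trans (ℕ.≤-reflexive (ℕ.+-identityʳ _)) (ℕ.⌊n/2⌋≤⌈n/2⌉ m)))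
      (ℕ.≤-reflexive (ℕ.⌊n/2⌋+⌈n/2⌉≡n m))
    coloured-α : Fin n → Bool
    coloured-α v = adj G u v ∧ ⌊ colour u v ≟ α ⌋
    members : ∀ {v} → v ∈ filterᵇ coloured-α (allFin n) → adj G u v ≡ true × colour u v ≡ α
    members v∈ =
      let uv , is-α = Equivalence.to Bool.T-∧ (proj₂ (∈-filter⁻ (T? ∘ coloured-α) {xs = allFin n} v∈))
      in Equivalence.to Bool.T-≡ uv , toWitness is-α
    bound : ∀ {v} → v ∈ filterᵇ coloured-α (allFin n) → proj₁ (spot u v) < ⌊ degree G u /2⌋
    bound v∈ = place-bound _ (δ≥2 u) (position<length (∈-neighbours (proj₁ (members v∈))))
    same-piece : ∀ {v w} → v ∈ filterᵇ coloured-α (allFin n) → w ∈ filterᵇ coloured-α (allFin n) →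
      proj₁ (spot u v) ≡ proj₁ (spot u w) → v ≡ w
    same-piece {v} {w} v∈ w∈ e =
      let uv , v-α = members v∈
          uw , w-α = members w∈
          mate-v = subst (λ γ → mate c γ (end u v) ≡ just (end v u)) v-α (colour-mate uv)
          mate-w = subst (λ γ → mate c γ (end u w) ≡ just (end w u)) w-α (colour-mate uw)
      -- At a common piece `mate c α` has a single value, so the far ends `end v u` and `end w u`
      -- coincide, and with them `v` and `w`.
      in cong proj₁ (just-injective
           (trans (≡.sym mate-v) (trans (cong (λ p → mate c α (u , p)) e) mate-w)))
    at-most-half : colorDegree edgeColoring u α ≤ ⌊ degree G u /2⌋
    at-most-half = unique-length≤ (Unique.filter⁺ (T? ∘ coloured-α) (Unique.allFin⁺ n))
      (λ v → proj₁ (spot u v)) bound same-piece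

theorem2 : (n : ℕ) (G : SimpleGraph n) → MinDegree≥ G 2 →
    Σ (EdgeColoring G 4) (λ c → IsMajority c)
theorem2 n G δ≥2 = edgeColoring , majority
  where open Split G δ≥2
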